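{- Suppose that $\mathcal D=(\mathcal P,\mathcal B,\mathcal I)$ is a non-trivial $G$-pairwise transitive $2$-design, where $G\le\mathrm{Aut}(\mathcal D)$, and that there exists a $G$-invariant partition $\mathcal S$ of $\mathcal B$ such that $G^{\mathcal S}$ is $2$-transitive. If the actions $G^{\mathcal S}$ and $G^{\mathcal P}$ are equivalent, then the parts of $\mathcal S$ have size $1$, and $\mathcal D$ is the complete design $C_{v,v-1}$, where $v=|\mathcal P|$.
   Context: A design $\mathcal D=(\mathcal P,\mathcal B,\mathcal I)$ consists of finite sets $\mathcal P$ (points), $\mathcal B$ (blocks) and an incidence relation $\mathcal I\subseteq\mathcal P\times\mathcal B$. It is a $2$-$(v,k,\lambda)$ design (or $2$-design) if $|\mathcal P|=v$, each block is incident with exactly $k$ points, and each pair of distinct points is incident with exactly $\lambda$ common blocks. It is non-trivial if $2<k<v$. The complete design $C_{v,k}$ has $v$ points and, for each $k$-subset $S$ of points, exactly one block whose set of incident points is $S$. An automorphism is a permutation of $\mathcal P\cup\mathcal B$ leaving $\mathcal P$ and $\mathcal B$ invariant setwise and preserving incidence; $\mathrm{Aut}(\mathcal D)$ is the group of all automorphisms. Two blocks are intersecting if some point is incident with both. For $G\le\mathrm{Aut}(\mathcal D)$, the $2$-design $\mathcal D$ is $G$-pairwise transitive if $G$ is transitive on each of the following five (possibly empty) sets of ordered pairs: pairs of distinct points, incident point-block pairs, non-incident point-block pairs, pairs of distinct intersecting blocks, pairs of non-intersecting blocks. $G^{X}$ denotes the permutation group induced by $G$ on $X$; the actions on $\mathcal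 S$ and $\mathcal P$ are equivalent if there is a $G$-equivariant bijection $\mathcal P\to\mathcal S$. -}

module Defs where

open import Algebra.Bundles using (Group)
open import Data.Fin using (Fin)
open import Data.Fin.Permutation using (Permutation′; _⟨$⟩ʳ_; _⟨$⟩ˡ_; _∘ₚ_; flip; inverseˡ; inverseʳ) renaming (_≈_ to _≈ₚ_; id to idₚ)
open import Data.Fin.Subset using (Subset; _∈_; ∣_∣; Nonempty; _∩_)
open import Data.Nat using (ℕ; _<_)
open import Data.Product using (∃; ∃!; _×_; _,_)
open import Data.Vec using (lookup; tabulate)
open import Function using (_⇔_; mk⇔; module Equivalence)
open import Function.Definitions using (Injective)
open import Level using (0ℓ)
open import Relation.Binary using (REL; Decidable)
open import Relation.Binary.PropositionalEquality using (_≡_; _≢_; refl; sym; trans; cong; subst₂)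
open import Relation.Nullary using (¬_; does)
open import Relation.Unary using (Pred)

-- The finite sets of points and of blocks are Fin v and Fin b. Distinct blocks
-- may be incident with the same points.
record Design (v b : ℕ) : Set₁ where
  infix 4 _I_ _I?_
  field
    _I_  : REL (Fin v) (Fin b) 0ℓ
    _I?_ : Decidable _I_

  pointsOf : Fin b → Subset v
  pointsOf x = tabulate (λ p → does (p I? x))

  blocksOn : Fin v → Subset b
  blocksOn p = tabulate (λ x → does (p I? x))

  Intersecting : Fin b → Fin b → Set
  Intersecting x y = ∃ λ p → p I x × p I y

record Is2Design {v b : ℕ} (D : Design v b) (k λ′ : ℕ) : Set where
  open Design D
  field
    block-size : ∀ x → ∣ pointsOf x ∣ ≡ k
    balanced   : ∀ p q → p ≢ q → ∣ blocksOn p ∩ blocksOn q ∣ ≡ λ′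

NonTrivial : (v k : ℕ) → Set
NonTrivial v k = 2 < k × k < v

record IsCompleteDesign {v b : ℕ} (D : Design v b) (k : ℕ) : Set where
  open Design D
  field
    block-size   : ∀ x → ∣ pointsOf x ∣ ≡ k
    unique-block : ∀ (S : Subset v) → ∣ S ∣ ≡ k → ∃! _≡_ (λ x → pointsOf x ≡ S)

-- A permutation of the disjoint union of points and blocks that leaves both
-- sets invariant is given by its restrictions to the two sets.
record Automorphism {v b : ℕ} (D : Design v b) : Set where
  open Design D
  field
    onPoints           : Permutation′ v
    onBlocks           : Permutation′ b
    preservesIncidence : ∀ p x → p I x ⇔ (onPoints ⟨$⟩ʳ p) I (onBlocks ⟨$⟩ʳ x)

module _ {v b : ℕ} {D : Design v b} where
  open Automorphism

  infixl 5 _·ᵖ_ _·ᵇ_ _·ˢ_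

  _·ᵖ_ : Automorphism D → Fin v → Fin v
  g ·ᵖ p = onPoints g ⟨$⟩ʳ p

  _·ᵇ_ : Automorphism D → Fin b → Fin b
  g ·ᵇ x = onBlocks g ⟨$⟩ʳ x

  -- The image { g ·ᵇ x ∣ x ∈ S }: y lies in it iff its preimage under g lies in S.
  _·ˢ_ : Automorphism D → Subset b → Subset b
  g ·ˢ S = tabulate (λ y → lookup S (onBlocks g ⟨$⟩ˡ y))

private
  flip-cong : ∀ {n} (π ρ : Permutation′ n) → π ≈ₚ ρ → flip π ≈ₚ flip ρ
  flip-cong π ρ π≈ρ i =
    trans (sym (inverseˡ ρ)) (cong (ρ ⟨$⟩ˡ_) (trans (sym (π≈ρ (π ⟨$⟩ˡ i))) (inverseʳ π)))

-- Products act from left to right: (g ∙ h) ·ᵖ p is h ·ᵖ (g ·ᵖ p).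
Aut : {v b : ℕ} → Design v b → Group 0ℓ 0ℓ
Aut {v} {b} D = record
  { Carrier = Automorphism D
  ; _≈_     = λ g h → onPoints g ≈ₚ onPoints h × onBlocks g ≈ₚ onBlocks h
  ; _∙_     = λ g h → record
    { onPoints           = onPoints g ∘ₚ onPoints h
    ; onBlocks           = onBlocks g ∘ₚ onBlocks h
    ; preservesIncidence = λ p x → mk⇔
        (λ i → to (preservesIncidence h _ _) (to (preservesIncidence g p x) i))
        (λ i → from (preservesIncidence g p x) (from (preservesIncidence h _ _) i))
    }
  ; ε       = record
    { onPoints           = idₚ
    ; onBlocks           = idₚ
    ; preservesIncidence = λ _ _ → mk⇔ (λ i → i) (λ i → i)
    }
  ; _⁻¹     = λ g → record
    { onPoints           = flip (onPoints g)
    ; onBlocks           = flip (onBlocks g)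
    ; preservesIncidence = λ p x → mk⇔
        (λ i → from (preservesIncidence g _ _)
                 (subst₂ _I_ (sym (inverseʳ (onPoints g))) (sym (inverseʳ (onBlocks g))) i))
        (λ i → subst₂ _I_ (inverseʳ (onPoints g)) (inverseʳ (onBlocks g))
                 (to (preservesIncidence g _ _) i))
    }
  ; isGroup = record
    { isMonoid = record
      { isSemigroup = record
        { isMagma = record
          { isEquivalence = record
            { refl  = (λ _ → refl) , (λ _ → refl)
            ; sym   = λ (p , q) → (λ i → sym (p i)) , (λ i → sym (q i))
            ; trans = λ (p , q) (r , s) → (λ i → trans (p i) (r i)) , (λ i → trans (q i) (s i))
            }
          ; ∙-cong = λ {_} {_} {h} {h′} (p , q) (r , s) →
              (λ i → trans (cong (onPoints h ⟨$⟩ʳ_) (p i)) (r _)) ,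
              (λ i → trans (cong (onBlocks h ⟨$⟩ʳ_) (q i)) (s _))
          }
        ; assoc = λ _ _ _ → (λ _ → refl) , (λ _ → refl)
        }
      ; identity = (λ _ → (λ _ → refl) , (λ _ → refl)) , (λ _ → (λ _ → refl) , (λ _ → refl))
      }
    ; inverse =
        (λ g → (λ _ → inverseʳ (onPoints g)) , (λ _ → inverseʳ (onBlocks g))) ,
        (λ g → (λ _ → inverseˡ (onPoints g)) , (λ _ → inverseˡ (onBlocks g)))
    ; ⁻¹-cong = λ {g} {h} (p , q) →
        flip-cong (onPoints g) (onPoints h) p , flip-cong (onBlocks g) (onBlocks h) q
    }
  }
  where
  open Design D
  open Automorphism
  open Equivalence using (to; from)

record Subgroup (𝔾 : Group 0ℓ 0ℓ) : Set₁ where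
  open Group 𝔾 using (Carrier; _≈_; _∙_; ε; _⁻¹)
  field
    Member    : Pred Carrier 0ℓ
    resp-≈    : ∀ {g h} → g ≈ h → Member g → Member h
    ε-closed  : Member ε
    ∙-closed  : ∀ {g h} → Member g → Member h → Member (g ∙ h)
    ⁻¹-closed : ∀ {g} → Member g → Member (g ⁻¹)

  TransitiveOnPairs : {X Y : Set} → (Carrier → X → X) → (Carrier → Y → Y) → REL X Y 0ℓ → Set
  TransitiveOnPairs _·₁_ _·₂_ R = ∀ {x y x′ y′} → R x y → R x′ y′ →
    ∃ λ g → Member g × (g ·₁ x) ≡ x′ × (g ·₂ y) ≡ y′

open Subgroup public using (Member; TransitiveOnPairs)

record PairwiseTransitive {v b : ℕ} (D : Design v b) (G : Subgroup (Aut D)) : Set where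
  open Design D
  field
    distinctPoints        : TransitiveOnPairs G _·ᵖ_ _·ᵖ_ _≢_
    flags                 : TransitiveOnPairs G _·ᵖ_ _·ᵇ_ _I_
    antiflags             : TransitiveOnPairs G _·ᵖ_ _·ᵇ_ (λ p x → ¬ (p I x))
    intersectingBlocks    : TransitiveOnPairs G _·ᵇ_ _·ᵇ_ (λ x y → x ≢ y × Intersecting x y)
    nonIntersectingBlocks : TransitiveOnPairs G _·ᵇ_ _·ᵇ_ (λ x y → ¬ Intersecting x y)

record IsPartition {n : ℕ} (𝒮 : Pred (Subset n) 0ℓ) : Set where
  field
    nonempty    : ∀ {S} → 𝒮 S → Nonempty S
    unique-part : ∀ x → ∃! _≡_ (λ S → 𝒮 S × x ∈ S)

module _ {v b : ℕ} {D : Design v b} (G : Subgroup (Aut D)) (𝒮 : Pred (Subset b) 0ℓ) where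

  Invariant : Set
  Invariant = ∀ {g} → Member G g → ∀ {S} → 𝒮 S → 𝒮 (g ·ˢ S)

  TwoTransitiveOnParts : Set
  TwoTransitiveOnParts = TransitiveOnPairs G _·ˢ_ _·ˢ_ (λ S T → 𝒮 S × 𝒮 T × S ≢ T)

  record EquivalentToPoints : Set where
    field
      φ           : Fin v → Subset b
      φ-part      : ∀ p → 𝒮 (φ p)
      injective   : Injective _≡_ _≡_ φ
      surjective  : ∀ {S} → 𝒮 S → ∃ λ p → φ p ≡ S
      equivariant : ∀ {g} → Member G g → ∀ p → φ (g ·ᵖ p) ≡ g ·ˢ φ p

{-# OPTIONS --safe #-}
-- The equivalence sends each block x to the point π x corresponding to the part
-- containing x, and π is G-equivariant, so the stabiliser of x fixes π x. If π x
-- were on x, flag-transitivity would make it the only point on x, so π x is not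
-- on x, and by antiflag-transitivity it is the only point off x. Thus k = v − 1.
-- Any two blocks now intersect, so two distinct blocks with the same image under
-- π could be mapped to two blocks with different images: hence π is a bijection.
module Submission where

open import Defs
open import Data.Fin.Base using (Fin; zero; suc)
open import Data.Fin.Permutation using (inverseˡ)
open import Data.Fin.Properties using (any?) renaming (_≟_ to _≟ᶠ_)
open import Data.Fin.Subset using (Subset; ∣_∣; _∈_; _∉_; _⊆_; ⁅_⁆; ∁; ⊥; ⊤; inside; outside)
open import Data.Fin.Subset.Properties using (_∈?_; ⊆-antisym; p⊆q⇒∣p∣≤∣q∣; x∈⁅x⁆; x∈⁅y⁆⇒x≡y; x≢y⇒x∉⁅y⁆; x∉⁅y⁆⇒x≢y; x∈∁p⇒x∉p; x∉p⇒x∈∁p; ∣⁅x⁆∣≡1; ∣⊥∣≡0; ∣∁p∣≡n∸∣p∣; ∣p∣≡n⇒p≡⊤)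
open import Data.Nat using (ℕ; suc; _∸_; _<_; z≤n; >-nonZero)
open import Data.Nat.Properties using (<⇒≱; <-trans; ≤-<-trans; n<1+n; suc-injective; suc-pred)
open import Data.Product using (_×_; _,_; ∃; ∃!; proj₁; proj₂)
open import Data.Vec using (_∷_; lookup)
open import Data.Vec.Properties using (lookup∘tabulate; []=⇒lookup; lookup⇒[]=)
open import Function using (_∘_)
open import Level using (0ℓ)
open import Relation.Binary.PropositionalEquality using (_≡_; _≢_; refl; sym; trans; cong; subst; subst₂)
open import Relation.Nullary using (¬_; yes; no; contradiction; ¬?)
open import Relation.Nullary.Decidable using (dec-true; _×-dec_; decidable-stable)
open import Relation.Unary using (Pred)

∣q∣<∣p∣⇒p⊈q : ∀ {n} (p q : Subset n) → ∣ q ∣ < ∣ p ∣ → ∃ λ x → x ∈ p × x ∉ q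
∣q∣<∣p∣⇒p⊈q p q q<p with any? (λ x → (x ∈? p) ×-dec ¬? (x ∈? q))
... | yes found = found
... | no  none  = contradiction (p⊆q⇒∣p∣≤∣q∣ p⊆q) (<⇒≱ q<p)
  where
  p⊆q : p ⊆ q
  p⊆q {x} x∈p = decidable-stable (x ∈? q) (λ x∉q → none (x , x∈p , x∉q))

∁⊥≡⊤ : ∀ n → ∁ (⊥ {n}) ≡ ⊤
∁⊥≡⊤ n = ∣p∣≡n⇒p≡⊤ (trans (∣∁p∣≡n∸∣p∣ (⊥ {n})) (cong (n ∸_) (∣⊥∣≡0 n)))

-- The first `outside` entry is the missing point; the cardinality then forces every later entry to
-- be `inside`.
1+∣p∣≡n⇒p≡∁⁅x⁆ : ∀ {n} (p : Subset n) → suc ∣ p ∣ ≡ n → ∃ λ x → p ≡ ∁ ⁅ x ⁆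
1+∣p∣≡n⇒p≡∁⁅x⁆ {suc n} (outside ∷ p) eq =
  zero , cong (outside ∷_) (trans (∣p∣≡n⇒p≡⊤ (suc-injective eq)) (sym (∁⊥≡⊤ n)))
1+∣p∣≡n⇒p≡∁⁅x⁆ (inside ∷ p) eq with 1+∣p∣≡n⇒p≡∁⁅x⁆ p (suc-injective eq)
... | x , p≡ = suc x , cong (inside ∷_) p≡

∣∁⁅x⁆∣≡n∸1 : ∀ {n} (x : Fin n) → ∣ ∁ ⁅ x ⁆ ∣ ≡ n ∸ 1
∣∁⁅x⁆∣≡n∸1 {n} x = trans (∣∁p∣≡n∸∣p∣ ⁅ x ⁆) (cong (n ∸_) (∣⁅x⁆∣≡1 x))

∁⁅⁆-injective : ∀ {n} {x y : Fin n} → ∁ ⁅ x ⁆ ≡ ∁ ⁅ y ⁆ → x ≡ y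
∁⁅⁆-injective {x = x} {y} eq = decidable-stable (x ≟ᶠ y) λ x≢y →
  x∈∁p⇒x∉p (subst (x ∈_) (sym eq) (x∉p⇒x∈∁p (x≢y⇒x∉⁅y⁆ x≢y))) (x∈⁅x⁆ x)

module _ {v b : ℕ} (D : Design v b) where
  open Design D

  ∈-pointsOf⁺ : ∀ {p x} → p I x → p ∈ pointsOf x
  ∈-pointsOf⁺ {p} {x} pIx =
    lookup⇒[]= p _ (trans (lookup∘tabulate _ p) (dec-true (p I? x) pIx))

  ∈-pointsOf⁻ : ∀ {p x} → p ∈ pointsOf x → p I x
  ∈-pointsOf⁻ {p} {x} p∈x
    with p I? x | trans (sym (lookup∘tabulate _ p)) ([]=⇒lookup p∈x)
  ... | yes pIx | _ = pIx
  ... | no  _   | ()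

  ·ˢ-∈ : ∀ (g : Automorphism D) {x S} → x ∈ S → (g ·ᵇ x) ∈ (g ·ˢ S)
  ·ˢ-∈ g {x} {S} x∈S = lookup⇒[]= (g ·ᵇ x) _
    (trans (lookup∘tabulate _ (g ·ᵇ x))
    (trans (cong (lookup S) (inverseˡ (Automorphism.onBlocks g))) ([]=⇒lookup x∈S)))

module PartsAsPoints
  {v b k λ′ : ℕ} (D : Design v b) (G : Subgroup (Aut D))
  (2design : Is2Design D k λ′) (nontrivial : NonTrivial v k) (transitive : PairwiseTransitive D G)
  (𝒮 : Pred (Subset b) 0ℓ) (partition : IsPartition 𝒮)
  (equivalent : EquivalentToPoints G 𝒮) where

  open Design D
  open Is2Design 2design
  open PairwiseTransitive transitive
  open IsPartition partition
  open EquivalentToPoints equivalent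

  part-unique : ∀ {x S T} → 𝒮 S → x ∈ S → 𝒮 T → x ∈ T → S ≡ T
  part-unique {x} 𝒮S x∈S 𝒮T x∈T with unique-part x
  ... | _ , _ , unique = trans (sym (unique (𝒮S , x∈S))) (unique (𝒮T , x∈T))

  locate : ∀ x → ∃ λ p → x ∈ φ p
  locate x with unique-part x
  ... | S , (𝒮S , x∈S) , _ with surjective 𝒮S
  ... | p , refl = p , x∈S

  π : Fin b → Fin v
  π = proj₁ ∘ locate

  -- Membership alone pins down `π x`, whichever witness `locate` picks: parts sharing a block
  -- coincide, and `φ` is injective.
  ∈φ⇒π≡ : ∀ {x p} → x ∈ φ p → π x ≡ p
  ∈φ⇒π≡ {x} x∈φp = injective (part-unique (φ-part _) (proj₂ (locate x)) (φ-part _) x∈φp)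

  -- Applying `g` to `x ∈ φ (π x)` puts `g ·ᵇ x` in the part `φ (g ·ᵖ π x)`, and membership
  -- determines `π`.
  π-equivariant : ∀ {g} → Member G g → ∀ x → π (g ·ᵇ x) ≡ (g ·ᵖ π x)
  π-equivariant {g} g∈G x =
    ∈φ⇒π≡ (subst ((g ·ᵇ x) ∈_) (sym (equivariant g∈G (π x))) (·ˢ-∈ D g (proj₂ (locate x))))

  π-surjective : ∀ p → ∃ λ x → π x ≡ p
  π-surjective p with nonempty (φ-part p)
  ... | x , x∈φp = x , ∈φ⇒π≡ x∈φp

  -- The premise is what flag- or antiflag-transitivity yields for two pairs with the same block
  -- `x`, the first being `(π x , x)`. By equivariance, `g` fixes `π x` once it fixes `x`.
  stabiliser-fixes-π : ∀ {x q} → (∃ λ g → Member G g × (g ·ᵖ π x) ≡ q × (g ·ᵇ x) ≡ x) → q ≡ π x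
  stabiliser-fixes-π {x} (g , g∈G , gπx≡q , gx≡x) =
    trans (sym gπx≡q) (trans (sym (π-equivariant g∈G x)) (cong π gx≡x))

  -- Since `2 < k`, no block fits inside the singleton of `p`.
  point-on-other-than : ∀ x p → ∃ λ q → q I x × q ≢ p
  point-on-other-than x p
    with ∣q∣<∣p∣⇒p⊈q (pointsOf x) ⁅ p ⁆
           (subst₂ _<_ (sym (∣⁅x⁆∣≡1 p)) (sym (block-size x)) (<-trans (n<1+n 1) (proj₁ nontrivial)))
  ... | q , q∈x , q∉p = q , ∈-pointsOf⁻ D q∈x , x∉⁅y⁆⇒x≢y q∉p

  π-off-block : ∀ x → ¬ (π x I x)
  π-off-block x πxIx with point-on-other-than x (π x)
  ... | q , qIx , q≢πx = q≢πx (stabiliser-fixes-π (flags πxIx qIx))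

  off-block⇒π : ∀ {x q} → ¬ (q I x) → q ≡ π x
  off-block⇒π {x} ¬qIx = stabiliser-fixes-π (antiflags (π-off-block x) ¬qIx)

  pointsOf≡∁⁅π⁆ : ∀ x → pointsOf x ≡ ∁ ⁅ π x ⁆
  pointsOf≡∁⁅π⁆ x = ⊆-antisym
    (λ q∈x → x∉p⇒x∈∁p (x≢y⇒x∉⁅y⁆ λ { refl → π-off-block x (∈-pointsOf⁻ D q∈x) }))
    (λ {q} q∈∁ → ∈-pointsOf⁺ D (decidable-stable (q I? x)
      λ ¬qIx → x∉⁅y⁆⇒x≢y (x∈∁p⇒x∉p q∈∁) (off-block⇒π ¬qIx)))

  -- `π y` is the only point off `y`, so any other point of `x` is on both blocks.
  all-intersecting : ∀ x y → Intersecting x y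
  all-intersecting x y with point-on-other-than x (π y)
  ... | q , qIx , q≢πy = q , qIx , decidable-stable (q I? y) (q≢πy ∘ off-block⇒π)

  -- The fibres of `π` are the parts, and equivariance makes every element of `G` permute them.
  same-part-transported : ∀ {x y x′ y′} → π x ≡ π y →
    (∃ λ g → Member G g × (g ·ᵇ x) ≡ x′ × (g ·ᵇ y) ≡ y′) → π x′ ≡ π y′
  same-part-transported {x} {y} πx≡πy (g , g∈G , gx≡x′ , gy≡y′) =
    trans (cong π (sym gx≡x′))
    (trans (π-equivariant g∈G x)
    (trans (cong (g ·ᵖ_) πx≡πy)
    (trans (sym (π-equivariant g∈G y)) (cong π gy≡y′))))

  π-injective : ∀ {x y} → π x ≡ π y → x ≡ y
  π-injective {x} {y} πx≡πy = decidable-stable (x ≟ᶠ y) λ x≢y →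
    -- The block `z` lies over a point other than `π x`. All blocks meet, so some element of `G`
    -- maps the pair `(x , y)` to `(x , z)`, which would force `π x ≡ π z`.
    let q , _ , q≢πx = point-on-other-than x (π x)
        z , πz≡q     = π-surjective q
        πx≢πz        = λ πx≡πz → q≢πx (trans (sym πz≡q) (sym πx≡πz))
    in πx≢πz (same-part-transported πx≡πy
         (intersectingBlocks (x≢y , all-intersecting x y) (πx≢πz ∘ cong π , all-intersecting x z)))

  -- `φ p` is the fibre of `π` over `p`, and injectivity leaves only one block in it.
  φ-singleton : ∀ {x p} → x ∈ φ p → φ p ≡ ⁅ x ⁆
  φ-singleton {x} x∈φp = ⊆-antisym
    (λ y∈φp → subst (_∈ ⁅ x ⁆) (π-injective (trans (∈φ⇒π≡ x∈φp) (sym (∈φ⇒π≡ y∈φp)))) (x∈⁅x⁆ x))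
    (λ y∈⁅x⁆ → subst (_∈ φ _) (sym (x∈⁅y⁆⇒x≡y x y∈⁅x⁆)) x∈φp)

  part-size : ∀ {S} → 𝒮 S → ∣ S ∣ ≡ 1
  part-size 𝒮S =
    let p , φp≡S = surjective 𝒮S
        x , x∈φp = nonempty (φ-part p)
    in trans (cong ∣_∣ (trans (sym φp≡S) (φ-singleton x∈φp))) (∣⁅x⁆∣≡1 x)

  complete : IsCompleteDesign D (v ∸ 1)
  complete = record
    { block-size   = λ x → trans (cong ∣_∣ (pointsOf≡∁⁅π⁆ x)) (∣∁⁅x⁆∣≡n∸1 (π x))
    ; unique-block = unique-block
    }
    where
    unique-block : ∀ S → ∣ S ∣ ≡ v ∸ 1 → ∃! _≡_ (λ x → pointsOf x ≡ S)
    unique-block S ∣S∣≡v∸1 =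
      -- As `∸` truncates, `suc (v ∸ 1) ≡ v` requires `v` to be positive, which follows from
      -- `k < v`.
      let instance v≢0 = >-nonZero (≤-<-trans z≤n (proj₂ nontrivial))
          p , S≡∁⁅p⁆ = 1+∣p∣≡n⇒p≡∁⁅x⁆ S (trans (cong suc ∣S∣≡v∸1) (suc-pred v))
          x , πx≡p   = π-surjective p
          x≡S        = trans (pointsOf≡∁⁅π⁆ x) (trans (cong (∁ ∘ ⁅_⁆) πx≡p) (sym S≡∁⁅p⁆))
      -- Blocks with equal point sets miss the same point, so injectivity of `π` excludes repeated
      -- blocks.
      in x , x≡S , λ {y} y≡S → π-injective (∁⁅⁆-injective
           (trans (sym (pointsOf≡∁⁅π⁆ x)) (trans x≡S (trans (sym y≡S) (pointsOf≡∁⁅π⁆ y)))))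

lemma2p7 : (v b k λ′ : ℕ) (D : Design v b) (G : Subgroup (Aut D)) →
    Is2Design D k λ′ → NonTrivial v k → PairwiseTransitive D G →
    (𝒮 : Pred (Subset b) 0ℓ) → IsPartition 𝒮 →
    Invariant G 𝒮 → TwoTransitiveOnParts G 𝒮 → EquivalentToPoints G 𝒮 →
    (∀ {S} → 𝒮 S → ∣ S ∣ ≡ 1) × IsCompleteDesign D (v ∸ 1)
lemma2p7 v b k λ′ D G 2design nontrivial transitive 𝒮 partition _ _ equivalent =
  part-size , complete
  where open PartsAsPoints D G 2design nontrivial transitive 𝒮 partition equivalent
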